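{- Let $(c_n)_{n\ge0}$ be a sequence of nonzero numbers with $c_0=1$, let $\omega$ be an umbra with $\omega^n\simeq n!/c_n$ (nonzero moments), and let $\gamma,\alpha,\sigma,\rho$ be umbrae. Let $\gamma',\alpha'$ be umbrae such that the matrix product of the exponential Riordan arrays satisfies $(\gamma,\alpha)(\sigma,\rho)=(\gamma',\alpha')$. Then \[ {}_\omega(\gamma,\alpha)\,{}_\omega(\sigma,\rho)={}_\omega(\gamma',\alpha'), \] and, if $(\gamma,\alpha)^{ -1}=(\gamma'',\alpha'')$ as exponential Riordan arrays, then \[ \big[{}_\omega(\gamma,\alpha)\big]^{ -1}={}_\omega(\gamma'',\alpha'')={}_\omega(\mathfrak L_{\gamma,\alpha},\mathfrak L_{\alpha}). \]
   Context: Classical umbral calculus: $R=\mathbb{C}[x]$, $A$ a saturated alphabet of umbrae, $E:R[A]\to R$ linear with $E[1]=1$ and $E[\alpha^i\beta^j\cdots]=E[\alpha^i]E[\beta^j]\cdots$ for distinct umbrae; $p\simeq q$ means $E[p]=E[q]$, $p\equiv q$ means $p^n\simeq q^n$ for all $n$. $f_\alpha(t)=\sum_n E[\alpha^n]t^n/n!$. For $x$ an integer (possibly negative), $x.\alpha$ is an umbra with $(x.\alpha)^n\simeq n![t^n]f_\alpha(t)^x$. For umbrae $\sigma,\alpha$, $\mathfrak K_{\sigma,\alpha}$ is an umbra with $\mathfrak K_{\sigma,\alpha}^0=1$, $\mathfrak K_{\sigma,\alpha}^n\simeq\sigma(\sigma+(-n).\alpha)^{n-1}$ for $n\ge1$ ($(-n).\alpha$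 uncorrelated with $\sigma$); $\mathfrak L_{\sigma,\alpha}:=(-1).\mathfrak K_{\sigma,\alpha}$ and $\mathfrak L_\alpha:=\mathfrak L_{\alpha,\alpha}$. The $\omega$-Riordan array ${}_\omega(\gamma,\alpha)$ is the lower triangular matrix with entries ${}_\omega(\gamma,\alpha)_{n,k}=E\!\left[\frac{c_n}{c_k}\frac{(\gamma+k.\alpha)^{n-k}}{(n-k)!}\right]$ ($n\ge k\ge0$, $\gamma$ and $k.\alpha$ uncorrelated); the exponential Riordan array $(\gamma,\alpha)$ is the case $c_n=n!$, i.e. $(\gamma,\alpha)_{n,k}=E\big[\binom{n}{k}(\gamma+k.\alpha)^{n-k}\big]$. Exponential Riordan arrays form a group under matrix multiplication, so products and inverses of such arrays are again of the form $(\gamma',\alpha')$. -}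

module Defs where

open import Level using (Level)
open import Algebra.Bundles using (CommutativeRing)
open import Data.Nat using (ℕ; zero; suc; _∸_; _≤?_; _≟_)
open import Data.Nat.Combinatorics using (_C_)
open import Data.Integer using (ℤ; +_; -[1+_])
open import Data.List using (List; []; _∷_)
open import Relation.Nullary using (yes; no)

-- All constructions are parametrised by a commutative ring R (the ring of
-- values of the evaluation E; in the paper R = ℂ[x]).
module _ {a ℓ : Level} (R : CommutativeRing a ℓ) where
  open CommutativeRing R

  -- Umbrae are represented by their moment sequences  n ↦ E[α^n].
  Seq : Set a
  Seq = ℕ → Carrier

  -- Infinite matrices, indexed (row, column).
  Mat : Set a
  Mat = ℕ → ℕ → Carrier

  fromℕ : ℕ → Carrier
  fromℕ zero    = 0#
  fromℕ (suc n) = 1# + fromℕ n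

  sumTo : ℕ → (ℕ → Carrier) → Carrier
  sumTo zero    f = 0#
  sumTo (suc n) f = sumTo n f + f n

  unitSeq : Seq
  unitSeq zero    = 1#
  unitSeq (suc _) = 0#

  -- moments of α + β for uncorrelated α, β:
  --   E[(α+β)^n] = Σ_j C(n,j) E[α^j] E[β^(n-j)]
  conv : Seq → Seq → Seq
  conv α β n = sumTo (suc n) (λ j → fromℕ (n C j) * (α j * β (n ∸ j)))

  -- k.α for k ∈ ℕ : exponential generating function f_α(t)^k
  dotℕ : ℕ → Seq → Seq
  dotℕ zero    α = unitSeq
  dotℕ (suc k) α = conv α (dotℕ k α)

  -- (-1).α : coefficients of f_α(t)^(-1) (assuming E[α^0] = 1), computed by
  -- the recursion  b_0 = 1,
  --   b_(n+1) = - Σ_(j=1..n+1) C(n+1,j) E[α^j] b_(n+1-j).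
  -- invRev α n = [b_n , b_(n-1) , ... , b_0]
  private
    wsum : (ℕ → Carrier → Carrier) → ℕ → List Carrier → Carrier
    wsum f i []       = 0#
    wsum f i (x ∷ xs) = f i x + wsum f (suc i) xs

    hd : List Carrier → Carrier
    hd []      = 0#
    hd (x ∷ _) = x

  invRev : Seq → ℕ → List Carrier
  invRev α zero    = 1# ∷ []
  invRev α (suc n) =
    (- wsum (λ i b → fromℕ (suc n C suc i) * (α (suc i) * b)) 0 (invRev α n))
    ∷ invRev α n

  negInv : Seq → Seq
  negInv α n = hd (invRev α n)

  -- x.α for x ∈ ℤ : f_α(t)^x ; for x = -(m+1) this is (m+1).((-1).α)
  dotℤ : ℤ → Seq → Seq
  dotℤ (+ n)      α = dotℕ n α
  dotℤ -[1+ m ]   α = dotℕ (suc m) (negInv α)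

  -- 𝔎_{σ,α}:  𝔎^0 = 1,  𝔎^n ≃ σ (σ + (-n).α)^(n-1)  (n ≥ 1)
  --   E[σ (σ+β)^m] = Σ_j C(m,j) E[σ^(j+1)] E[β^(m-j)]
  𝔎 : Seq → Seq → Seq
  𝔎 σ α zero    = 1#
  𝔎 σ α (suc m) =
    sumTo (suc m) (λ j → fromℕ (m C j) * (σ (suc j) * dotℤ -[1+ m ] α (m ∸ j)))

  𝔏 : Seq → Seq → Seq
  𝔏 σ α = dotℤ -[1+ 0 ] (𝔎 σ α)

  𝔏₁ : Seq → Seq
  𝔏₁ α = 𝔏 α α

  -- exponential Riordan array (γ,α)_{n,k} = E[C(n,k) (γ + k.α)^(n-k)], zero above diagonal
  expRiordan : Seq → Seq → Mat
  expRiordan γ α n k with k ≤? n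
  ... | yes _ = fromℕ (n C k) * conv γ (dotℕ k α) (n ∸ k)
  ... | no  _ = 0#

  -- ω-Riordan array, with c n / c k written c n * cinv k and 1/(n-k)!
  -- written ifact (n-k), where cinv, ifact are inverses of c, factorials.
  ωRiordan : (c cinv ifact : ℕ → Carrier) → Seq → Seq → Mat
  ωRiordan c cinv ifact γ α n k with k ≤? n
  ... | yes _ = ((c n * cinv k) * ifact (n ∸ k)) * conv γ (dotℕ k α) (n ∸ k)
  ... | no  _ = 0#

  -- product of (lower triangular) infinite matrices
  _·_ : Mat → Mat → Mat
  (A · B) n k = sumTo (suc n) (λ j → A n j * B j k)

  idMat : Mat
  idMat n k with n ≟ k
  ... | yes _ = 1#
  ... | no  _ = 0#

  _≋_ : Mat → Mat → Set ℓ
  A ≋ B = ∀ n k → A n k ≈ B n k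

  IsInverseOf : Mat → Mat → Set ℓ
  IsInverseOf B A = ((A · B) ≋ idMat) × ((B · A) ≋ idMat)
    where open import Data.Product using (_×_)

{-# OPTIONS --safe #-}
-- With c_n / n! on the diagonal of Δ, the ω-Riordan array is Δ (γ,α) Δ⁻¹, so products and
-- inverses carry over from exponential Riordan arrays.  For the inverse, let S be the
-- substitution u ↦ u(t f_α(t)).  Columns 0 and 1 of (γ,α)(γ″,α″) = I say γ · S γ″ = 1 and
-- α · S α″ = 1.  By Lagrange inversion σ ↦ 𝔎_{σ,α} is inverse to S, and S is multiplicative,
-- so these equations read 𝔎_{γ,α} · γ″ = 1 and 𝔎_{α,α} · α″ = 1.
-- Everything about the convolution product is derived from the fact that the shift
-- D u n = u (n + 1), differentiation of exponential generating functions, is a derivation.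
module Submission where

open import Defs
open import Level using (Level)
open import Algebra.Bundles using (CommutativeRing; CommutativeSemiring)
open import Algebra.Structures.Biased using (isCommutativeSemiringˡ)
open import Data.List using (List; []; _∷_)
open import Data.Nat using (ℕ; zero; suc; _∸_; _≤_; _<_; s≤s; _≤?_; _≟_; _!)
import Data.Nat as ℕ
import Data.Nat.Properties as ℕₚ
open import Data.Nat.Combinatorics using (_C_; nCn≡1; nC1≡n; k>n⇒nCk≡0; nCk+nC[k+1]≡[n+1]C[k+1]; nCk≡n!/k![n-k]!; k![n∸k]!∣n!)
open import Data.Nat.DivMod using (m/n*n≡m)
open import Data.Product using (_×_; _,_)
open import Data.Sum using (inj₁; inj₂)
open import Relation.Nullary using (yes; no; contradiction)
open import Relation.Binary.Structures using (IsEquivalence)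
open import Relation.Binary.PropositionalEquality as ≡ using (_≡_; _≢_)
import Algebra.Properties.Group as GroupProperties
import Algebra.Solver.Ring.NaturalCoefficients.Default as NaturalSolver
import Relation.Binary.Reasoning.Setoid as SetoidReasoning

AreReciprocal : ∀ {a ℓ} (R : CommutativeRing a ℓ) (u v : ℕ → CommutativeRing.Carrier R) → Set ℓ
AreReciprocal R u v = ∀ n → u n * v n ≈ 1#
  where open CommutativeRing R

-- Finite sums and the image of the natural numbers in the ring.

module ScalarSums {a ℓ : Level} (R : CommutativeRing a ℓ) where
  open CommutativeRing R
  open SetoidReasoning setoid
  open NaturalSolver commutativeSemiring using (solve; _:+_; _:*_; _:=_)

  Σ< : ℕ → (ℕ → Carrier) → Carrier
  Σ< = sumTo R

  ι : ℕ → Carrier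
  ι = fromℕ R

  ι1 : ι 1 ≈ 1#
  ι1 = +-identityʳ 1#

  ι-+ : ∀ m n → ι (m ℕ.+ n) ≈ ι m + ι n
  ι-+ zero    n = sym (+-identityˡ _)
  ι-+ (suc m) n = trans (+-congˡ (ι-+ m n)) (sym (+-assoc _ _ _))

  ι-* : ∀ m n → ι (m ℕ.* n) ≈ ι m * ι n
  ι-* zero    n = sym (zeroˡ _)
  ι-* (suc m) n = begin
    ι (n ℕ.+ m ℕ.* n)       ≈⟨ ι-+ n (m ℕ.* n) ⟩
    ι n + ι (m ℕ.* n)       ≈⟨ +-cong (sym (*-identityˡ _)) (ι-* m n) ⟩
    1# * ι n + ι m * ι n    ≈⟨ distribʳ _ _ _ ⟨
    (1# + ι m) * ι n        ∎

  ι-cong : ∀ {m n} → m ≡ n → ι m ≈ ι n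
  ι-cong ≡.refl = refl

  ι-C-vanish : ∀ {n k} → n < k → ι (n C k) ≈ 0#
  ι-C-vanish n<k = ι-cong (k>n⇒nCk≡0 n<k)

  ι-C-diag : ∀ n → ι (n C n) ≈ 1#
  ι-C-diag n = trans (ι-cong (nCn≡1 n)) ι1

  ι-pascal : ∀ n k → ι (suc n C suc k) ≈ ι (n C k) + ι (n C suc k)
  ι-pascal n k = trans (ι-cong (≡.sym (nCk+nC[k+1]≡[n+1]C[k+1] n k))) (ι-+ (n C k) (n C suc k))

  Σ<-cong : ∀ n {f g : ℕ → Carrier} → (∀ j → j < n → f j ≈ g j) → Σ< n f ≈ Σ< n g
  Σ<-cong zero    e = refl
  Σ<-cong (suc n) e = +-cong (Σ<-cong n (λ j p → e j (ℕₚ.m<n⇒m<1+n p))) (e n ℕₚ.≤-refl)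

  Σ<-zero : ∀ n {f : ℕ → Carrier} → (∀ j → j < n → f j ≈ 0#) → Σ< n f ≈ 0#
  Σ<-zero zero    e = refl
  Σ<-zero (suc n) e =
    trans (+-cong (Σ<-zero n (λ j p → e j (ℕₚ.m<n⇒m<1+n p))) (e n ℕₚ.≤-refl)) (+-identityˡ 0#)

  Σ<-+ : ∀ n (f g : ℕ → Carrier) → Σ< n (λ j → f j + g j) ≈ Σ< n f + Σ< n g
  Σ<-+ zero    f g = sym (+-identityˡ 0#)
  Σ<-+ (suc n) f g = trans (+-congʳ (Σ<-+ n f g))
    (solve 4 (λ a b c d → (a :+ b) :+ (c :+ d) := (a :+ c) :+ (b :+ d)) refl _ _ _ _)

  Σ<-*ˡ : ∀ n r (f : ℕ → Carrier) → Σ< n (λ j → r * f j) ≈ r * Σ< n f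
  Σ<-*ˡ zero    r f = sym (zeroʳ r)
  Σ<-*ˡ (suc n) r f = trans (+-congʳ (Σ<-*ˡ n r f)) (sym (distribˡ _ _ _))

  Σ<-*ʳ : ∀ n r (f : ℕ → Carrier) → Σ< n (λ j → f j * r) ≈ Σ< n f * r
  Σ<-*ʳ zero    r f = sym (zeroˡ r)
  Σ<-*ʳ (suc n) r f = trans (+-congʳ (Σ<-*ʳ n r f)) (sym (distribʳ _ _ _))

  Σ<-head : ∀ n (f : ℕ → Carrier) → Σ< (suc n) f ≈ f 0 + Σ< n (λ j → f (suc j))
  Σ<-head zero    f = +-comm _ _
  Σ<-head (suc n) f = trans (+-congʳ (Σ<-head n f)) (+-assoc _ _ _)

  Σ<-truncate : ∀ m n (f : ℕ → Carrier) → m ≤ n → (∀ j → m ≤ j → f j ≈ 0#) → Σ< n f ≈ Σ< m f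
  Σ<-truncate m n f m≤n vanish with ℕₚ.m≤n⇒m<n∨m≡n m≤n
  ... | inj₂ ≡.refl = refl
  Σ<-truncate m (suc n) f m≤n vanish | inj₁ (s≤s m≤n′) =
    trans (+-cong (Σ<-truncate m n f m≤n′ vanish) (vanish n m≤n′)) (+-identityʳ _)

-- Exponential generating functions under the binomial convolution product.

module ExponentialSeries {a ℓ : Level} (R : CommutativeRing a ℓ) where
  open CommutativeRing R
  open ScalarSums R
  open NaturalSolver commutativeSemiring using (solve; _:+_; _:*_; _:=_)

  infix  4 _≐_
  infixl 7 _⊗_
  infixl 6 _⊕_

  -- A record instead of the bare pointwise statement, so that unification recovers both series from
  -- the type of a proof.
  record _≐_ (u v : Seq R) : Set ℓ where
    constructor ⟨_⟩
    field at : ∀ n → u n ≈ v n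
  open _≐_ public

  D : Seq R → Seq R
  D u n = u (suc n)

  _⊗_ : Seq R → Seq R → Seq R
  _⊗_ = conv R

  _⊕_ : Seq R → Seq R → Seq R
  (u ⊕ v) n = u n + v n

  𝟘 : Seq R
  𝟘 _ = 0#

  𝟙 : Seq R
  𝟙 = unitSeq R

  D-cong : ∀ {u v} → u ≐ v → D u ≐ D v
  D-cong e .at n = e .at (suc n)

  -- Coefficient n of a product involves only coefficients of degree at most n of its factors.
  -- Inductions on the degree know equality only up to such a bound.
  ⊗-cong≤ : ∀ n {u u′ v v′} → (∀ m → m ≤ n → u m ≈ u′ m) → (∀ m → m ≤ n → v m ≈ v′ m) →
            (u ⊗ v) n ≈ (u′ ⊗ v′) n
  ⊗-cong≤ n eu ev = Σ<-cong (suc n) (λ j j≤n →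
    *-congˡ (*-cong (eu j (ℕₚ.≤-pred j≤n)) (ev (n ∸ j) (ℕₚ.m∸n≤m n j))))

  ⊗-cong : ∀ {u u′ v v′} → u ≐ u′ → v ≐ v′ → u ⊗ v ≐ u′ ⊗ v′
  ⊗-cong eu ev .at n = ⊗-cong≤ n (λ m _ → eu .at m) (λ m _ → ev .at m)

  ⊗-congˡ : ∀ w {u v} → u ≐ v → w ⊗ u ≐ w ⊗ v
  ⊗-congˡ w e = ⊗-cong {w} ⟨ (λ _ → refl) ⟩ e

  ⊗-congʳ : ∀ w {u v} → u ≐ v → u ⊗ w ≐ v ⊗ w
  ⊗-congʳ w e = ⊗-cong e (⟨_⟩ {w} (λ _ → refl))

  ⊗-0 : ∀ u v → (u ⊗ v) 0 ≈ u 0 * v 0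
  ⊗-0 u v = trans (+-identityˡ _) (trans (*-congʳ ι1) (*-identityˡ _))

  -- Pascal's rule splits every term with j > 0 in two. One half is `D u ⊗ v`; the other half,
  -- joined with the term j = 0, is `u ⊗ D v` together with a top term that vanishes because
  -- `n C suc n` is 0.
  leibniz : ∀ u v n → (u ⊗ v) (suc n) ≈ (D u ⊗ v) n + (u ⊗ D v) n
  leibniz u v n = begin
    (u ⊗ v) (suc n)
      ≈⟨ Σ<-head (suc n) _ ⟩
    first + Σ< (suc n) (λ j → ι (suc n C suc j) * (u (suc j) * v (n ∸ j)))
      ≈⟨ +-congˡ (Σ<-cong (suc n) (λ j _ → trans (*-congʳ (ι-pascal n j)) (distribʳ _ _ _))) ⟩
    first + Σ< (suc n) (λ j → ι (n C j) * (u (suc j) * v (n ∸ j)) + ι (n C suc j) * (u (suc j) * v (n ∸ j)))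
      ≈⟨ +-congˡ (Σ<-+ (suc n) _ _) ⟩
    first + ((D u ⊗ v) n + Σ< (suc n) (λ j → ι (n C suc j) * (u (suc j) * v (n ∸ j))))
      ≈⟨ solve 3 (λ a b c → a :+ (b :+ c) := b :+ (a :+ c)) refl _ _ _ ⟩
    (D u ⊗ v) n + (first + Σ< (suc n) (λ j → ι (n C suc j) * (u (suc j) * v (n ∸ j))))
      ≈⟨ +-congˡ (Σ<-head (suc n) (λ j → ι (n C j) * (u j * v (suc n ∸ j)))) ⟨
    (D u ⊗ v) n + (Σ< (suc n) (λ j → ι (n C j) * (u j * v (suc n ∸ j))) + ι (n C suc n) * (u (suc n) * v (n ∸ n)))
      ≈⟨ +-congˡ (+-cong
           (Σ<-cong (suc n) (λ j j≤n → *-congˡ (*-congˡ (reflexive (≡.cong v (ℕₚ.+-∸-assoc 1 (ℕₚ.≤-pred j≤n)))))))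
           (trans (*-congʳ (ι-C-vanish {n} {suc n} ℕₚ.≤-refl)) (zeroˡ _))) ⟩
    (D u ⊗ v) n + ((u ⊗ D v) n + 0#)
      ≈⟨ +-congˡ (+-identityʳ _) ⟩
    (D u ⊗ v) n + (u ⊗ D v) n ∎
    where
    open SetoidReasoning setoid
    first = ι (n C 0) * (u 0 * v (suc n))

  D-⊗ : ∀ u v → D (u ⊗ v) ≐ (D u ⊗ v) ⊕ (u ⊗ D v)
  D-⊗ u v .at = leibniz u v

  -- Induction on the degree with both series left general: `leibniz` expresses coefficient n + 1 by
  -- coefficients n of products containing `D u` or `D v`. The unit and associativity laws are
  -- proved by the same device.
  ⊗-comm : ∀ u v n → (u ⊗ v) n ≈ (v ⊗ u) n
  ⊗-comm u v zero    = trans (⊗-0 u v) (trans (*-comm _ _) (sym (⊗-0 v u)))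
  ⊗-comm u v (suc n) = begin
    (u ⊗ v) (suc n)            ≈⟨ leibniz u v n ⟩
    (D u ⊗ v) n + (u ⊗ D v) n  ≈⟨ +-cong (⊗-comm (D u) v n) (⊗-comm u (D v) n) ⟩
    (v ⊗ D u) n + (D v ⊗ u) n  ≈⟨ +-comm _ _ ⟩
    (D v ⊗ u) n + (v ⊗ D u) n  ≈⟨ leibniz v u n ⟨
    (v ⊗ u) (suc n)            ∎
    where open SetoidReasoning setoid

  ⊗-zeroˡ : ∀ u n → (𝟘 ⊗ u) n ≈ 0#
  ⊗-zeroˡ u n = Σ<-zero (suc n) (λ j _ → trans (*-congˡ (zeroˡ _)) (zeroʳ _))

  ⊗-distribʳ : ∀ w u v n → ((u ⊕ v) ⊗ w) n ≈ (u ⊗ w) n + (v ⊗ w) n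
  ⊗-distribʳ w u v n = trans
    (Σ<-cong (suc n) (λ j _ → solve 4 (λ c x y z → c :* ((x :+ y) :* z) := c :* (x :* z) :+ c :* (y :* z)) refl _ _ _ _))
    (Σ<-+ (suc n) _ _)

  ⊗-distribˡ : ∀ w u v n → (w ⊗ (u ⊕ v)) n ≈ (w ⊗ u) n + (w ⊗ v) n
  ⊗-distribˡ w u v n =
    trans (⊗-comm w (u ⊕ v) n) (trans (⊗-distribʳ w u v n) (+-cong (⊗-comm u w n) (⊗-comm v w n)))

  ⊗-identityˡ : ∀ u n → (𝟙 ⊗ u) n ≈ u n
  ⊗-identityˡ u zero    = trans (⊗-0 𝟙 u) (*-identityˡ _)
  ⊗-identityˡ u (suc n) =
    trans (leibniz 𝟙 u n) (trans (+-cong (⊗-zeroˡ u n) (⊗-identityˡ (D u) n)) (+-identityˡ _))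

  ⊗-assoc : ∀ u v w n → ((u ⊗ v) ⊗ w) n ≈ (u ⊗ (v ⊗ w)) n
  ⊗-assoc u v w zero = begin
    ((u ⊗ v) ⊗ w) 0      ≈⟨ ⊗-0 (u ⊗ v) w ⟩
    (u ⊗ v) 0 * w 0      ≈⟨ *-congʳ (⊗-0 u v) ⟩
    (u 0 * v 0) * w 0    ≈⟨ *-assoc _ _ _ ⟩
    u 0 * (v 0 * w 0)    ≈⟨ *-congˡ (⊗-0 v w) ⟨
    u 0 * (v ⊗ w) 0      ≈⟨ ⊗-0 u (v ⊗ w) ⟨
    (u ⊗ (v ⊗ w)) 0      ∎
    where open SetoidReasoning setoid
  ⊗-assoc u v w (suc n) = begin
    ((u ⊗ v) ⊗ w) (suc n)
      ≈⟨ leibniz (u ⊗ v) w n ⟩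
    (D (u ⊗ v) ⊗ w) n + ((u ⊗ v) ⊗ D w) n
      ≈⟨ +-congʳ (⊗-congʳ w (D-⊗ u v) .at n) ⟩
    (((D u ⊗ v) ⊕ (u ⊗ D v)) ⊗ w) n + ((u ⊗ v) ⊗ D w) n
      ≈⟨ +-congʳ (⊗-distribʳ w (D u ⊗ v) (u ⊗ D v) n) ⟩
    (((D u ⊗ v) ⊗ w) n + ((u ⊗ D v) ⊗ w) n) + ((u ⊗ v) ⊗ D w) n
      ≈⟨ +-cong (+-cong (⊗-assoc (D u) v w n) (⊗-assoc u (D v) w n)) (⊗-assoc u v (D w) n) ⟩
    ((D u ⊗ (v ⊗ w)) n + (u ⊗ (D v ⊗ w)) n) + (u ⊗ (v ⊗ D w)) n
      ≈⟨ +-assoc _ _ _ ⟩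
    (D u ⊗ (v ⊗ w)) n + ((u ⊗ (D v ⊗ w)) n + (u ⊗ (v ⊗ D w)) n)
      ≈⟨ +-congˡ (⊗-distribˡ u (D v ⊗ w) (v ⊗ D w) n) ⟨
    (D u ⊗ (v ⊗ w)) n + (u ⊗ ((D v ⊗ w) ⊕ (v ⊗ D w))) n
      ≈⟨ +-congˡ (⊗-congˡ u (D-⊗ v w) .at n) ⟨
    (D u ⊗ (v ⊗ w)) n + (u ⊗ D (v ⊗ w)) n
      ≈⟨ leibniz u (v ⊗ w) n ⟨
    (u ⊗ (v ⊗ w)) (suc n) ∎
    where open SetoidReasoning setoid

  -- This makes the semiring solver available for series. Identities that would carry a minus sign
  -- are accordingly stated below as a sum equal to `𝟘`.
  seqSemiring : CommutativeSemiring a ℓ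
  seqSemiring = record
    { Carrier = Seq R
    ; _≈_ = _≐_
    ; _+_ = _⊕_
    ; _*_ = _⊗_
    ; 0# = 𝟘
    ; 1# = 𝟙
    ; isCommutativeSemiring = isCommutativeSemiringˡ (record
      { +-isCommutativeMonoid = record
        { isMonoid = record
          { isSemigroup = record
            { isMagma = record
              { isEquivalence = ≐-isEquivalence
              ; ∙-cong = λ p q → ⟨ (λ n → +-cong (p .at n) (q .at n)) ⟩ }
            ; assoc = λ u v w → ⟨ (λ n → +-assoc _ _ _) ⟩ }
          ; identity = (λ u → ⟨ (λ n → +-identityˡ _) ⟩) , (λ u → ⟨ (λ n → +-identityʳ _) ⟩) }
        ; comm = λ u v → ⟨ (λ n → +-comm _ _) ⟩ }
      ; *-isCommutativeMonoid = record
        { isMonoid = record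
          { isSemigroup = record
            { isMagma = record { isEquivalence = ≐-isEquivalence ; ∙-cong = ⊗-cong }
            ; assoc = λ u v w → ⟨ ⊗-assoc u v w ⟩ }
          ; identity = (λ u → ⟨ ⊗-identityˡ u ⟩)
                     , (λ u → ⟨ (λ n → trans (⊗-comm u 𝟙 n) (⊗-identityˡ u n)) ⟩) }
        ; comm = λ u v → ⟨ ⊗-comm u v ⟩ }
      ; distribʳ = λ w u v → ⟨ ⊗-distribʳ w u v ⟩
      ; zeroˡ = λ u → ⟨ ⊗-zeroˡ u ⟩ })
    }
    where
    ≐-isEquivalence : IsEquivalence _≐_
    ≐-isEquivalence = record
      { refl = ⟨ (λ _ → refl) ⟩
      ; sym = λ p → ⟨ (λ n → sym (p .at n)) ⟩
      ; trans = λ p q → ⟨ (λ n → trans (p .at n) (q .at n)) ⟩ }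

  module 𝕊 = CommutativeSemiring seqSemiring

-- Reciprocals of series with constant term 1.

module Reciprocal {a ℓ : Level} (R : CommutativeRing a ℓ) where
  open CommutativeRing R
  open ScalarSums R
  open ExponentialSeries R

  weightedSum : (ℕ → Carrier → Carrier) → ℕ → List Carrier → Carrier
  weightedSum f i []       = 0#
  weightedSum f i (x ∷ xs) = f i x + weightedSum f (suc i) xs

  -- The two recursion equations determine the sum, so any function satisfying them can be replaced
  -- by `weightedSum` without access to its definition.
  weightedSum-unique : (W : (ℕ → Carrier → Carrier) → ℕ → List Carrier → Carrier) →
    (∀ f i → W f i [] ≈ 0#) → (∀ f i x xs → W f i (x ∷ xs) ≈ f i x + W f (suc i) xs) →
    ∀ f i xs → W f i xs ≈ weightedSum f i xs
  weightedSum-unique W nil cons f i []       = nil f i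
  weightedSum-unique W nil cons f i (x ∷ xs) =
    trans (cons f i x xs) (+-congˡ (weightedSum-unique W nil cons f (suc i) xs))

  -- The weighted sum inside invRev is private to its module.  Once all its arguments
  -- are abstracted to variables, unification solves the body of invRevSum with it.
  mutual
    invRevSum : (ℕ → Carrier → Carrier) → ℕ → List Carrier → Carrier
    invRevSum = _

    negInv-suc : ∀ u n → negInv R u (suc n) ≈
      - weightedSum (λ i b → ι (suc n C suc i) * (u (suc i) * b)) 0 (invRev R u n)
    negInv-suc u n with (λ i b → ι (suc n C suc i) * (u (suc i) * b))
    ... | f with 0 | invRev R u n
    ...   | i | xs =
      -‿cong (weightedSum-unique invRevSum (λ _ _ → refl) (λ _ _ _ _ → refl) f i xs)

  -- The list holds the coefficients of the reciprocal from degree n down to 0, hence the argument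
  -- `n ∸ j` at position j. The starting index i is general because the tail starts at i + 1.
  weightedSum-invRev : ∀ u n f i →
    weightedSum f i (invRev R u n) ≈ Σ< (suc n) (λ j → f (j ℕ.+ i) (negInv R u (n ∸ j)))
  weightedSum-invRev u zero    f i = +-comm _ _
  weightedSum-invRev u (suc n) f i = trans
    (+-congˡ (trans (weightedSum-invRev u n f (suc i))
      (Σ<-cong (suc n) (λ j _ → reflexive (≡.cong (λ i′ → f i′ (negInv R u (n ∸ j))) (ℕₚ.+-suc j i))))))
    (sym (Σ<-head (suc n) _))

  -- The recursion defines coefficient n + 1 of the reciprocal as minus the terms with j > 0 of the
  -- convolution, and the term j = 0 is that coefficient itself since u has constant term 1.
  ⊗-negInv : ∀ u → u 0 ≈ 1# → u ⊗ negInv R u ≐ 𝟙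
  ⊗-negInv u u0 .at zero    = trans (⊗-0 u (negInv R u)) (trans (*-identityʳ _) u0)
  ⊗-negInv u u0 .at (suc n) = begin
    (u ⊗ negInv R u) (suc n)
      ≈⟨ Σ<-head (suc n) _ ⟩
    ι 1 * (u 0 * negInv R u (suc n)) + tail
      ≈⟨ +-congʳ (trans (*-cong ι1 (*-congʳ u0)) (trans (*-identityˡ _) (*-identityˡ _))) ⟩
    negInv R u (suc n) + tail
      ≈⟨ +-congʳ (trans (negInv-suc u n) (-‿cong (trans (weightedSum-invRev u n _ 0)
           (Σ<-cong (suc n) (λ j _ → reflexive (≡.cong (λ i → ι (suc n C suc i) * (u (suc i) * negInv R u (n ∸ j))) (ℕₚ.+-identityʳ j))))))) ⟩
    - tail + tail
      ≈⟨ -‿inverseˡ tail ⟩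
    0# ∎
    where
    open SetoidReasoning setoid
    tail = Σ< (suc n) (λ j → ι (suc n C suc j) * (u (suc j) * negInv R u (n ∸ j)))

  reciprocal-unique : ∀ {u v w} → u ⊗ v ≐ 𝟙 → u ⊗ w ≐ 𝟙 → v ≐ w
  reciprocal-unique {u} {v} {w} uv uw = begin
    v            ≈⟨ 𝕊.*-identityʳ v ⟨
    v ⊗ 𝟙        ≈⟨ ⊗-congˡ v uw ⟨
    v ⊗ (u ⊗ w)  ≈⟨ solve 3 (λ u v w → v :* (u :* w) := (u :* v) :* w) 𝕊.refl u v w ⟩
    (u ⊗ v) ⊗ w  ≈⟨ ⊗-congʳ w uv ⟩
    𝟙 ⊗ w        ≈⟨ 𝕊.*-identityˡ w ⟩
    w            ∎
    where
    open SetoidReasoning 𝕊.setoid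
    open NaturalSolver seqSemiring using (solve; _:*_; _:=_)

-- Divided powers of t, powers of a series and their derivatives.

module DividedPowers {a ℓ : Level} (R : CommutativeRing a ℓ) where
  open CommutativeRing R
  open ScalarSums R
  open ExponentialSeries R

  infix 8 _^^_
  _^^_ : Seq R → ℕ → Seq R
  u ^^ k = dotℕ R k u

  -- The constant series r: scalar factors become series, so the solver for series can move them.
  scale : Carrier → Seq R
  scale r zero    = r
  scale r (suc _) = 0#

  scale-⊗ : ∀ r u n → (scale r ⊗ u) n ≈ r * u n
  scale-⊗ r u zero    = ⊗-0 (scale r) u
  scale-⊗ r u (suc n) =
    trans (leibniz (scale r) u n) (trans (+-cong (⊗-zeroˡ u n) (scale-⊗ r (D u) n)) (+-identityˡ _))

  scale-0 : scale 0# ≐ 𝟘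
  scale-0 .at zero    = refl
  scale-0 .at (suc _) = refl

  scale-1+ : ∀ r → scale (1# + r) ≐ 𝟙 ⊕ scale r
  scale-1+ r .at zero    = refl
  scale-1+ r .at (suc _) = sym (+-identityˡ 0#)

  -- τ k is the series t^k / k!.
  τ : ℕ → Seq R
  τ zero            = 𝟙
  τ (suc k) zero    = 0#
  τ (suc k) (suc n) = τ k n

  τ-diag : ∀ k → τ k k ≈ 1#
  τ-diag zero    = refl
  τ-diag (suc k) = τ-diag k

  τ-offdiag : ∀ n k → n ≢ k → τ k n ≈ 0#
  τ-offdiag zero    zero    n≢k = contradiction ≡.refl n≢k
  τ-offdiag (suc n) zero    n≢k = refl
  τ-offdiag zero    (suc k) n≢k = refl
  τ-offdiag (suc n) (suc k) n≢k = τ-offdiag n k (λ e → n≢k (≡.cong suc e))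

  -- The right-hand side is the shape of an entry of an exponential Riordan array, so this lemma
  -- lets the columns of such arrays be treated as series.
  τ-⊗ : ∀ k u n → (τ k ⊗ u) n ≈ ι (n C k) * u (n ∸ k)
  τ-⊗ zero    u n       = trans (⊗-identityˡ u n) (sym (trans (*-congʳ ι1) (*-identityˡ _)))
  τ-⊗ (suc k) u zero    = trans (⊗-0 (τ (suc k)) u) (trans (zeroˡ _) (sym (zeroˡ _)))
  τ-⊗ (suc k) u (suc n) = begin
    (τ (suc k) ⊗ u) (suc n)                                    ≈⟨ leibniz (τ (suc k)) u n ⟩
    (τ k ⊗ u) n + (τ (suc k) ⊗ D u) n                          ≈⟨ +-cong (τ-⊗ k u n) (τ-⊗ (suc k) (D u) n) ⟩
    ι (n C k) * u (n ∸ k) + ι (n C suc k) * u (suc (n ∸ suc k)) ≈⟨ +-congˡ second ⟩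
    ι (n C k) * u (n ∸ k) + ι (n C suc k) * u (n ∸ k)          ≈⟨ distribʳ _ _ _ ⟨
    (ι (n C k) + ι (n C suc k)) * u (n ∸ k)                    ≈⟨ *-congʳ (ι-pascal n k) ⟨
    ι (suc n C suc k) * u (n ∸ k)                              ∎
    where
    open SetoidReasoning setoid
    -- For k < n the two indices agree; otherwise truncated subtraction makes them differ, but the
    -- binomial coefficient is 0.
    second : ι (n C suc k) * u (suc (n ∸ suc k)) ≈ ι (n C suc k) * u (n ∸ k)
    second with suc k ≤? n
    ... | yes k<n = *-congˡ (reflexive (≡.cong u (≡.sym (ℕₚ.+-∸-assoc 1 k<n))))
    ... | no  k≮n = trans (trans (*-congʳ C≈0) (zeroˡ _)) (sym (trans (*-congʳ C≈0) (zeroˡ _)))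
      where C≈0 = ι-C-vanish (ℕₚ.≰⇒> k≮n)

  τ-⊗-vanish : ∀ {k n} u → n < k → (τ k ⊗ u) n ≈ 0#
  τ-⊗-vanish {k} {n} u n<k = trans (τ-⊗ k u n) (trans (*-congʳ (ι-C-vanish n<k)) (zeroˡ _))

  τ1-⊗-suc : ∀ u n → (τ 1 ⊗ u) (suc n) ≈ ι (suc n) * u n
  τ1-⊗-suc u n = trans (τ-⊗ 1 u (suc n)) (*-congʳ (ι-cong (nC1≡n (suc n))))

  τ1-⊗-τ : ∀ k → τ 1 ⊗ τ k ≐ scale (ι (suc k)) ⊗ τ (suc k)
  τ1-⊗-τ k .at zero    = trans (⊗-0 (τ 1) (τ k)) (trans (zeroˡ _) (sym (trans (scale-⊗ (ι (suc k)) (τ (suc k)) 0) (zeroʳ _))))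
  τ1-⊗-τ k .at (suc n) = trans (τ1-⊗-suc (τ k) n) (trans offdiag (sym (scale-⊗ (ι (suc k)) (τ (suc k)) (suc n))))
    where
    offdiag : ι (suc n) * τ k n ≈ ι (suc k) * τ k n
    offdiag with n ≟ k
    ... | yes ≡.refl = refl
    ... | no  n≢k    = trans (trans (*-congˡ (τ-offdiag n k n≢k)) (zeroʳ _))
                             (sym (trans (*-congˡ (τ-offdiag n k n≢k)) (zeroʳ _)))

  ^^-cong : ∀ {u v} → u ≐ v → ∀ k → u ^^ k ≐ v ^^ k
  ^^-cong e zero    = 𝕊.refl
  ^^-cong e (suc k) = ⊗-cong e (^^-cong e k)

  ^^-0 : ∀ u → u 0 ≈ 1# → ∀ k → (u ^^ k) 0 ≈ 1#
  ^^-0 u u0 zero    = refl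
  ^^-0 u u0 (suc k) = trans (⊗-0 u (u ^^ k)) (trans (*-cong u0 (^^-0 u u0 k)) (*-identityˡ 1#))

  ^^-cancel : ∀ {u v} → u ⊗ v ≐ 𝟙 → ∀ j p → v ^^ (j ℕ.+ p) ⊗ u ^^ j ≐ v ^^ p
  ^^-cancel uv zero    p = 𝕊.*-identityʳ _
  ^^-cancel {u} {v} uv (suc j) p = begin
    (v ⊗ v ^^ (j ℕ.+ p)) ⊗ (u ⊗ u ^^ j)  ≈⟨ solve 4 (λ v x u y → (v :* x) :* (u :* y) := (u :* v) :* (x :* y)) 𝕊.refl v (v ^^ (j ℕ.+ p)) u (u ^^ j) ⟩
    (u ⊗ v) ⊗ (v ^^ (j ℕ.+ p) ⊗ u ^^ j)  ≈⟨ ⊗-cong uv (^^-cancel uv j p) ⟩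
    𝟙 ⊗ v ^^ p                           ≈⟨ 𝕊.*-identityˡ _ ⟩
    v ^^ p                               ∎
    where
    open SetoidReasoning 𝕊.setoid
    open NaturalSolver seqSemiring using (solve; _:*_; _:=_)

  D-^^ : ∀ u k → D (u ^^ suc k) ≐ scale (ι (suc k)) ⊗ (u ^^ k ⊗ D u)
  D-^^ u k = 𝕊.trans (D-⊗ u (u ^^ k)) (𝕊.trans (rest k) (⊗-congʳ (u ^^ k ⊗ D u) (𝕊.sym (scale-1+ (ι k)))))
    where
    open SetoidReasoning 𝕊.setoid
    open NaturalSolver seqSemiring using (solve; _:*_; _:+_; _:=_; con)
    -- Of the k + 1 copies of `u ^^ k ⊗ D u`, one comes from the first summand of the product rule
    -- and k come from the second.
    rest : ∀ k → D u ⊗ u ^^ k ⊕ u ⊗ D (u ^^ k) ≐ (𝟙 ⊕ scale (ι k)) ⊗ (u ^^ k ⊗ D u)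
    rest zero = begin
      D u ⊗ 𝟙 ⊕ u ⊗ 𝟘               ≈⟨ solve 2 (λ d u → d :* con 1 :+ u :* con 0 := (con 1 :+ con 0) :* (con 1 :* d)) 𝕊.refl (D u) u ⟩
      (𝟙 ⊕ 𝟘) ⊗ (𝟙 ⊗ D u)           ≈⟨ ⊗-congʳ (𝟙 ⊗ D u) (𝕊.+-congˡ {x = 𝟙} scale-0) ⟨
      (𝟙 ⊕ scale 0#) ⊗ (𝟙 ⊗ D u)    ∎
    rest (suc k) = begin
      D u ⊗ u ^^ suc k ⊕ u ⊗ D (u ^^ suc k)
        ≈⟨ 𝕊.+-congˡ (⊗-congˡ u (D-^^ u k)) ⟩
      D u ⊗ (u ⊗ u ^^ k) ⊕ u ⊗ (scale (ι (suc k)) ⊗ (u ^^ k ⊗ D u))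
        ≈⟨ solve 4 (λ d u p s → d :* (u :* p) :+ u :* (s :* (p :* d)) := (con 1 :+ s) :* ((u :* p) :* d)) 𝕊.refl (D u) u (u ^^ k) (scale (ι (suc k))) ⟩
      (𝟙 ⊕ scale (ι (suc k))) ⊗ (u ^^ suc k ⊗ D u) ∎

  -- This is (1/u)′ = -u′/u², obtained by differentiating u v = 1 and multiplying by v.
  D-reciprocal : ∀ {u v} → u ⊗ v ≐ 𝟙 → D v ⊕ D u ⊗ (v ⊗ v) ≐ 𝟘
  D-reciprocal {u} {v} uv = begin
    D v ⊕ D u ⊗ (v ⊗ v)              ≈⟨ 𝕊.+-congʳ (𝕊.*-identityˡ (D v)) ⟨
    𝟙 ⊗ D v ⊕ D u ⊗ (v ⊗ v)          ≈⟨ 𝕊.+-congʳ (⊗-congʳ (D v) uv) ⟨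
    (u ⊗ v) ⊗ D v ⊕ D u ⊗ (v ⊗ v)    ≈⟨ solve 4 (λ u v u′ v′ → (u :* v) :* v′ :+ u′ :* (v :* v) := v :* (u′ :* v :+ u :* v′)) 𝕊.refl u v (D u) (D v) ⟩
    v ⊗ (D u ⊗ v ⊕ u ⊗ D v)          ≈⟨ ⊗-congˡ v (D-⊗ u v) ⟨
    v ⊗ D (u ⊗ v)                    ≈⟨ ⊗-congˡ v (D-cong uv) ⟩
    v ⊗ 𝟘                            ≈⟨ 𝕊.zeroʳ v ⟩
    𝟘                                ∎
    where
    open SetoidReasoning 𝕊.setoid
    open NaturalSolver seqSemiring using (solve; _:*_; _:+_; _:=_)

  -- This is the rule (u^(-p))′ = -p u′ u^(-p-1), which makes the residues of positive index vanish
  -- in the Lagrange inversion.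
  D-reciprocal-^^ : ∀ {u v} → u ⊗ v ≐ 𝟙 → ∀ p → D (v ^^ p) ⊕ scale (ι p) ⊗ (D u ⊗ v ^^ suc p) ≐ 𝟘
  D-reciprocal-^^ {u} {v} uv zero = begin
    𝟘 ⊕ scale 0# ⊗ (D u ⊗ v ^^ 1)   ≈⟨ 𝕊.+-identityˡ _ ⟩
    scale 0# ⊗ (D u ⊗ v ^^ 1)       ≈⟨ ⊗-congʳ (D u ⊗ v ^^ 1) scale-0 ⟩
    𝟘 ⊗ (D u ⊗ v ^^ 1)              ≈⟨ 𝕊.zeroˡ (D u ⊗ v ^^ 1) ⟩
    𝟘                               ∎
    where open SetoidReasoning 𝕊.setoid
  D-reciprocal-^^ {u} {v} uv (suc p) = begin
    D (v ⊗ v ^^ p) ⊕ scale (1# + ι p) ⊗ (D u ⊗ v ^^ suc (suc p))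
      ≈⟨ 𝕊.+-cong (D-⊗ v (v ^^ p)) (⊗-congʳ (D u ⊗ v ^^ suc (suc p)) (scale-1+ (ι p))) ⟩
    (D v ⊗ v ^^ p ⊕ v ⊗ D (v ^^ p)) ⊕ (𝟙 ⊕ scale (ι p)) ⊗ (D u ⊗ (v ⊗ (v ⊗ v ^^ p)))
      ≈⟨ solve 6 (λ v v′ x x′ u′ s → (v′ :* x :+ v :* x′) :+ (con 1 :+ s) :* (u′ :* (v :* (v :* x)))
                   := (v′ :+ u′ :* (v :* v)) :* x :+ v :* (x′ :+ s :* (u′ :* (v :* x))))
           𝕊.refl v (D v) (v ^^ p) (D (v ^^ p)) (D u) (scale (ι p)) ⟩
    (D v ⊕ D u ⊗ (v ⊗ v)) ⊗ v ^^ p ⊕ v ⊗ (D (v ^^ p) ⊕ scale (ι p) ⊗ (D u ⊗ v ^^ suc p))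
      ≈⟨ 𝕊.+-cong (⊗-congʳ (v ^^ p) (D-reciprocal uv)) (⊗-congˡ v (D-reciprocal-^^ uv p)) ⟩
    𝟘 ⊗ v ^^ p ⊕ v ⊗ 𝟘
      ≈⟨ 𝕊.+-cong (𝕊.zeroˡ (v ^^ p)) (𝕊.zeroʳ v) ⟩
    𝟘 ⊕ 𝟘
      ≈⟨ 𝕊.+-identityˡ 𝟘 ⟩
    𝟘 ∎
    where
    open SetoidReasoning 𝕊.setoid
    open NaturalSolver seqSemiring using (solve; _:*_; _:+_; _:=_; con)

-- Substitution u ↦ u(t f(t)), whose matrix is the exponential Riordan array of 𝟙 and f.
module Substitution {a ℓ : Level} (R : CommutativeRing a ℓ) (f : Seq R) where
  open CommutativeRing R
  open ScalarSums R
  open ExponentialSeries R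
  open DividedPowers R

  -- The series (t f(t))^j / j!.
  col : ℕ → Seq R
  col j = τ j ⊗ f ^^ j

  φ : Seq R
  φ = τ 1 ⊗ f

  -- Column j starts in degree j, so stopping the sum at j = n loses nothing of u(t f(t)).
  S : Seq R → Seq R
  S u n = Σ< (suc n) (λ j → col j n * u j)

  S-cong : ∀ {u v} → u ≐ v → S u ≐ S v
  S-cong e .at n = Σ<-cong (suc n) (λ j _ → *-congˡ (e .at j))

  S-⊕ : ∀ u v → S (u ⊕ v) ≐ S u ⊕ S v
  S-⊕ u v .at n = trans (Σ<-cong (suc n) (λ j _ → distribˡ _ _ _)) (Σ<-+ (suc n) _ _)

  S-0 : ∀ u → S u 0 ≈ u 0
  S-0 u = trans (+-identityˡ _) (trans (*-congʳ (⊗-identityˡ 𝟙 0)) (*-identityˡ _))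

  S-𝟙 : S 𝟙 ≐ 𝟙
  S-𝟙 .at n = begin
    S 𝟙 n                                           ≈⟨ Σ<-head n _ ⟩
    col 0 n * 1# + Σ< n (λ j → col (suc j) n * 0#)  ≈⟨ +-cong (*-identityʳ _) (Σ<-zero n (λ _ _ → zeroʳ _)) ⟩
    col 0 n + 0#                                    ≈⟨ +-identityʳ _ ⟩
    col 0 n                                         ≈⟨ ⊗-identityˡ 𝟙 n ⟩
    𝟙 n                                             ∎
    where open SetoidReasoning setoid

  ⊗-scalar : ∀ w u r n → (w ⊗ (λ m → u m * r)) n ≈ (w ⊗ u) n * r
  ⊗-scalar w u r n = trans
    (Σ<-cong (suc n) (λ j _ → solve 4 (λ c x y z → c :* (x :* (y :* z)) := (c :* (x :* y)) :* z) refl _ _ _ _))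
    (Σ<-*ʳ (suc n) r _)
    where open NaturalSolver commutativeSemiring using (solve; _:*_; _:=_)

  ⊗-Σ< : ∀ w N (F : ℕ → Seq R) (b : ℕ → Carrier) n →
    (w ⊗ (λ m → Σ< N (λ j → F j m * b j))) n ≈ Σ< N (λ j → (w ⊗ F j) n * b j)
  ⊗-Σ< w zero    F b n = trans (⊗-comm w 𝟘 n) (⊗-zeroˡ w n)
  ⊗-Σ< w (suc N) F b n = trans
    (⊗-distribˡ w (λ m → Σ< N (λ j → F j m * b j)) (λ m → F N m * b N) n)
    (+-cong (⊗-Σ< w N F b n) (⊗-scalar w (F N) (b N) n))

  -- For every m ≤ n the sum defining `S b m` can be lengthened to the common bound n, since the
  -- added columns vanish in degree m. The product with w then passes through a finite sum of fixed
  -- length.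
  ⊗-S : ∀ w b n → (w ⊗ S b) n ≈ Σ< (suc n) (λ j → (w ⊗ col j) n * b j)
  ⊗-S w b n = trans
    (⊗-cong≤ n {w} (λ _ _ → refl) (λ m m≤n → sym
      (Σ<-truncate (suc m) (suc n) (λ j → col j m * b j) (s≤s m≤n)
        (λ j m<j → trans (*-congʳ (τ-⊗-vanish (f ^^ j) m<j)) (zeroˡ _)))))
    (⊗-Σ< w (suc n) col b n)

  D-φ : D φ ≐ f ⊕ τ 1 ⊗ D f
  D-φ = 𝕊.trans (D-⊗ (τ 1) f) (𝕊.+-congʳ {x = τ 1 ⊗ D f} (𝕊.*-identityˡ f))

  -- The factor j + 1 from the power rule is absorbed by t · t^j/j! = (j+1) t^(j+1)/(j+1)!, so no
  -- division occurs, and the two summands combine to φ′ = f + t f′.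
  D-col : ∀ j → D (col (suc j)) ≐ D φ ⊗ col j
  D-col j = begin
    D (τ (suc j) ⊗ f ^^ suc j)
      ≈⟨ D-⊗ (τ (suc j)) (f ^^ suc j) ⟩
    τ j ⊗ (f ⊗ f ^^ j) ⊕ τ (suc j) ⊗ D (f ^^ suc j)
      ≈⟨ 𝕊.+-congˡ {x = τ j ⊗ (f ⊗ f ^^ j)} (⊗-congˡ (τ (suc j)) (D-^^ f j)) ⟩
    τ j ⊗ (f ⊗ f ^^ j) ⊕ τ (suc j) ⊗ (scale (ι (suc j)) ⊗ (f ^^ j ⊗ D f))
      ≈⟨ 𝕊.+-congˡ {x = τ j ⊗ (f ⊗ f ^^ j)}
           (solve 3 (λ t s p → t :* (s :* p) := (s :* t) :* p) 𝕊.refl (τ (suc j)) (scale (ι (suc j))) (f ^^ j ⊗ D f)) ⟩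
    τ j ⊗ (f ⊗ f ^^ j) ⊕ (scale (ι (suc j)) ⊗ τ (suc j)) ⊗ (f ^^ j ⊗ D f)
      ≈⟨ 𝕊.+-congˡ {x = τ j ⊗ (f ⊗ f ^^ j)} (⊗-congʳ (f ^^ j ⊗ D f) (τ1-⊗-τ j)) ⟨
    τ j ⊗ (f ⊗ f ^^ j) ⊕ (τ 1 ⊗ τ j) ⊗ (f ^^ j ⊗ D f)
      ≈⟨ solve 5 (λ t f p o f′ → t :* (f :* p) :+ (o :* t) :* (p :* f′) := (f :+ o :* f′) :* (t :* p))
           𝕊.refl (τ j) f (f ^^ j) (τ 1) (D f) ⟩
    (f ⊕ τ 1 ⊗ D f) ⊗ (τ j ⊗ f ^^ j)
      ≈⟨ ⊗-congʳ (col j) D-φ ⟨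
    D φ ⊗ col j ∎
    where
    open SetoidReasoning 𝕊.setoid
    open NaturalSolver seqSemiring using (solve; _:*_; _:+_; _:=_)

  -- Differentiation is termwise: the constant column 0 drops out and `D-col` extracts the common
  -- factor φ′ from the others.
  chain-rule : ∀ u → D (S u) ≐ D φ ⊗ S (D u)
  chain-rule u .at n = begin
    S u (suc n)
      ≈⟨ Σ<-head (suc n) _ ⟩
    col 0 (suc n) * u 0 + Σ< (suc n) (λ j → D (col (suc j)) n * D u j)
      ≈⟨ +-cong (trans (*-congʳ (⊗-identityˡ 𝟙 (suc n))) (zeroˡ _))
                (Σ<-cong (suc n) (λ j _ → *-congʳ (D-col j .at n))) ⟩
    0# + Σ< (suc n) (λ j → (D φ ⊗ col j) n * D u j)
      ≈⟨ +-identityˡ _ ⟩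
    Σ< (suc n) (λ j → (D φ ⊗ col j) n * D u j)
      ≈⟨ ⊗-S (D φ) (D u) n ⟨
    (D φ ⊗ S (D u)) n ∎
    where open SetoidReasoning setoid

  -- The chain rule expresses coefficient m + 1 through a product with φ′, which involves all lower
  -- coefficients. The induction therefore runs on a bound n, for all degrees below it and all
  -- series at once.
  S-⊗≤ : ∀ n u v m → m ≤ n → S (u ⊗ v) m ≈ (S u ⊗ S v) m
  S-⊗≤ n u v zero m≤n = begin
    S (u ⊗ v) 0    ≈⟨ S-0 (u ⊗ v) ⟩
    (u ⊗ v) 0      ≈⟨ ⊗-0 u v ⟩
    u 0 * v 0      ≈⟨ *-cong (S-0 u) (S-0 v) ⟨
    S u 0 * S v 0  ≈⟨ ⊗-0 (S u) (S v) ⟨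
    (S u ⊗ S v) 0  ∎
    where open SetoidReasoning setoid
  S-⊗≤ (suc n) u v (suc m) (s≤s m≤n) = begin
    S (u ⊗ v) (suc m)
      ≈⟨ chain-rule (u ⊗ v) .at m ⟩
    (D φ ⊗ S (D (u ⊗ v))) m
      ≈⟨ ⊗-congˡ (D φ) (𝕊.trans (S-cong (D-⊗ u v)) (S-⊕ (D u ⊗ v) (u ⊗ D v))) .at m ⟩
    (D φ ⊗ (S (D u ⊗ v) ⊕ S (u ⊗ D v))) m
      ≈⟨ ⊗-cong≤ m {D φ} (λ _ _ → refl) (λ i i≤m → +-cong
           (S-⊗≤ n (D u) v i (ℕₚ.≤-trans i≤m m≤n)) (S-⊗≤ n u (D v) i (ℕₚ.≤-trans i≤m m≤n))) ⟩
    (D φ ⊗ (S (D u) ⊗ S v ⊕ S u ⊗ S (D v))) m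
      ≈⟨ solve 5 (λ p a b c d → p :* (a :* b :+ c :* d) := (p :* a) :* b :+ c :* (p :* d))
           𝕊.refl (D φ) (S (D u)) (S v) (S u) (S (D v)) .at m ⟩
    ((D φ ⊗ S (D u)) ⊗ S v) m + (S u ⊗ (D φ ⊗ S (D v))) m
      ≈⟨ +-cong (⊗-congʳ (S v) (chain-rule u) .at m) (⊗-congˡ (S u) (chain-rule v) .at m) ⟨
    (D (S u) ⊗ S v) m + (S u ⊗ D (S v)) m
      ≈⟨ leibniz (S u) (S v) m ⟨
    (S u ⊗ S v) (suc m) ∎
    where
    open SetoidReasoning setoid
    open NaturalSolver seqSemiring using (solve; _:*_; _:+_; _:=_)

  S-⊗ : ∀ u v → S (u ⊗ v) ≐ S u ⊗ S v
  S-⊗ u v .at n = S-⊗≤ n u v n ℕₚ.≤-refl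

  S-τ1 : S (τ 1) ≐ φ
  S-τ1 .at zero    = trans (S-0 (τ 1)) (sym (trans (⊗-0 (τ 1) f) (zeroˡ _)))
  S-τ1 .at (suc n) = begin
    S (τ 1) (suc n)      ≈⟨ chain-rule (τ 1) .at n ⟩
    (D φ ⊗ S 𝟙) n        ≈⟨ ⊗-congˡ (D φ) S-𝟙 .at n ⟩
    (D φ ⊗ 𝟙) n          ≈⟨ 𝕊.*-identityʳ (D φ) .at n ⟩
    φ (suc n)            ∎
    where open SetoidReasoning setoid

-- 𝔎 u f is the series u(h), where h is the compositional inverse of t f(t).
module Lagrange {a ℓ : Level} (R : CommutativeRing a ℓ) (f : Seq R)
                (f0 : CommutativeRing._≈_ R (f 0) (CommutativeRing.1# R)) where
  open CommutativeRing R
  open ScalarSums R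
  open ExponentialSeries R
  open Reciprocal R
  open DividedPowers R
  open Substitution R f

  g : Seq R
  g = negInv R f

  fg : f ⊗ g ≐ 𝟙
  fg = ⊗-negInv f f0

  -- The residue of φ′ / φ^(p+1) is 1 for p = 0 and 0 otherwise.
  residue : ∀ p → (D φ ⊗ g ^^ suc p) p ≈ 𝟙 p
  residue p = trans (expand .at p) (evaluate p)
    where
    expand : D φ ⊗ g ^^ suc p ≐ g ^^ p ⊕ τ 1 ⊗ (D f ⊗ g ^^ suc p)
    expand = begin
      D φ ⊗ g ^^ suc p
        ≈⟨ ⊗-congʳ (g ^^ suc p) D-φ ⟩
      (f ⊕ τ 1 ⊗ D f) ⊗ (g ⊗ g ^^ p)
        ≈⟨ solve 5 (λ f o d g x → (f :+ o :* d) :* (g :* x) := (f :* g) :* x :+ o :* (d :* (g :* x)))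
             𝕊.refl f (τ 1) (D f) g (g ^^ p) ⟩
      (f ⊗ g) ⊗ g ^^ p ⊕ τ 1 ⊗ (D f ⊗ g ^^ suc p)
        ≈⟨ 𝕊.+-congʳ {x = τ 1 ⊗ (D f ⊗ g ^^ suc p)} (𝕊.trans (⊗-congʳ (g ^^ p) fg) (𝕊.*-identityˡ (g ^^ p))) ⟩
      g ^^ p ⊕ τ 1 ⊗ (D f ⊗ g ^^ suc p) ∎
      where
      open SetoidReasoning 𝕊.setoid
      open NaturalSolver seqSemiring using (solve; _:*_; _:+_; _:=_)
    evaluate : ∀ p → (g ^^ p ⊕ τ 1 ⊗ (D f ⊗ g ^^ suc p)) p ≈ 𝟙 p
    evaluate zero    = trans (+-congˡ (trans (⊗-0 (τ 1) (D f ⊗ g ^^ 1)) (zeroˡ _))) (+-identityʳ _)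
    -- Multiplication by t contributes the factor q + 1, so the sum is coefficient q of (g^(q+1))′ +
    -- (q+1) f′ g^(q+2), which vanishes because g = 1/f.
    evaluate (suc q) = begin
      (g ^^ suc q) (suc q) + (τ 1 ⊗ (D f ⊗ g ^^ suc (suc q))) (suc q)
        ≈⟨ +-congˡ (τ1-⊗-suc (D f ⊗ g ^^ suc (suc q)) q) ⟩
      D (g ^^ suc q) q + ι (suc q) * (D f ⊗ g ^^ suc (suc q)) q
        ≈⟨ +-congˡ (scale-⊗ (ι (suc q)) (D f ⊗ g ^^ suc (suc q)) q) ⟨
      (D (g ^^ suc q) ⊕ scale (ι (suc q)) ⊗ (D f ⊗ g ^^ suc (suc q))) q
        ≈⟨ D-reciprocal-^^ fg (suc q) .at q ⟩
      0# ∎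
      where open SetoidReasoning setoid

  -- With m = j + p, the powers of f and g cancel to g^(p+1). What is left is t^j/j! times φ′
  -- g^(p+1), and the shift by j leads to the residue of index p.
  residue-col : ∀ {j p m} → j ℕ.+ p ≡ m → ((g ^^ suc m ⊗ D φ) ⊗ col j) m ≈ ι (m C j) * 𝟙 p
  residue-col {j} {p} {m} ≡.refl = begin
    ((g ^^ suc m ⊗ D φ) ⊗ (τ j ⊗ f ^^ j)) m
      ≈⟨ solve 5 (λ g x d t y → ((g :* x) :* d) :* (t :* y) := t :* (d :* (g :* (x :* y))))
           𝕊.refl g (g ^^ m) (D φ) (τ j) (f ^^ j) .at m ⟩
    (τ j ⊗ (D φ ⊗ (g ⊗ (g ^^ m ⊗ f ^^ j)))) m
      ≈⟨ ⊗-congˡ (τ j) (⊗-congˡ (D φ) (⊗-congˡ g (^^-cancel fg j p))) .at m ⟩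
    (τ j ⊗ (D φ ⊗ g ^^ suc p)) m
      ≈⟨ τ-⊗ j (D φ ⊗ g ^^ suc p) m ⟩
    ι (m C j) * (D φ ⊗ g ^^ suc p) (m ∸ j)
      ≈⟨ *-congˡ (reflexive (≡.cong (D φ ⊗ g ^^ suc p) (ℕₚ.m+n∸m≡n j p))) ⟩
    ι (m C j) * (D φ ⊗ g ^^ suc p) p
      ≈⟨ *-congˡ (residue p) ⟩
    ι (m C j) * 𝟙 p ∎
    where
    open SetoidReasoning setoid
    open NaturalSolver seqSemiring using (solve; _:*_; _:=_)

  residue-below : ∀ {j m} → j < m → ((g ^^ suc m ⊗ D φ) ⊗ col j) m ≈ 0#
  residue-below {j} {m} j<m with ℕₚ.m≤n⇒∃[o]m+o≡n j<m
  ... | p , j+p+1≡m = trans (residue-col {j} {suc p} {m} (≡.trans (ℕₚ.+-suc j p) j+p+1≡m)) (zeroʳ _)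

  residue-diag : ∀ m → ((g ^^ suc m ⊗ D φ) ⊗ col m) m ≈ 1#
  residue-diag m = trans (residue-col {m} {0} {m} (ℕₚ.+-identityʳ m)) (trans (*-identityʳ _) (ι-C-diag m))

  -- Moment m + 1 of the left side unfolds to coefficient m of (S u)′ g^(m+1), and (S u)′ = φ′ ·
  -- S(u′). Expanding S(u′) in columns leaves residues, of which only the one with j = m survives,
  -- with value 1.
  𝔎-S : ∀ u → u 0 ≈ 1# → 𝔎 R (S u) f ≐ u
  𝔎-S u u0 .at zero    = sym u0
  𝔎-S u u0 .at (suc m) = begin
    (D (S u) ⊗ g ^^ suc m) m
      ≈⟨ ⊗-congʳ (g ^^ suc m) (chain-rule u) .at m ⟩
    ((D φ ⊗ S (D u)) ⊗ g ^^ suc m) m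
      ≈⟨ solve 3 (λ a b c → (a :* b) :* c := (c :* a) :* b) 𝕊.refl (D φ) (S (D u)) (g ^^ suc m) .at m ⟩
    ((g ^^ suc m ⊗ D φ) ⊗ S (D u)) m
      ≈⟨ ⊗-S (g ^^ suc m ⊗ D φ) (D u) m ⟩
    Σ< m (λ j → ((g ^^ suc m ⊗ D φ) ⊗ col j) m * D u j) + ((g ^^ suc m ⊗ D φ) ⊗ col m) m * D u m
      ≈⟨ +-cong (Σ<-zero m (λ j j<m → trans (*-congʳ (residue-below j<m)) (zeroˡ _))) (*-congʳ (residue-diag m)) ⟩
    0# + 1# * u (suc m)
      ≈⟨ trans (+-identityˡ _) (*-identityˡ _) ⟩
    u (suc m) ∎
    where
    open SetoidReasoning setoid
    open NaturalSolver seqSemiring using (solve; _:*_; _:=_)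

  𝔎-cong : ∀ {u v} → u ≐ v → 𝔎 R u f ≐ 𝔎 R v f
  𝔎-cong e .at zero    = refl
  𝔎-cong e .at (suc m) = ⊗-congʳ (g ^^ suc m) (D-cong e) .at m

  𝔎-𝟙 : 𝔎 R 𝟙 f ≐ 𝟙
  𝔎-𝟙 .at zero    = refl
  𝔎-𝟙 .at (suc m) = ⊗-zeroˡ (g ^^ suc m) m

  -- The system is triangular: moment m + 1 of `𝔎 R u f` is u (m + 1) plus a combination of lower
  -- moments of u, because the powers of g have constant term 1.
  𝔎-injective≤ : ∀ n {u v} → u 0 ≈ 1# → v 0 ≈ 1# → 𝔎 R u f ≐ 𝔎 R v f → ∀ m → m ≤ n → u m ≈ v m
  𝔎-injective≤ n u0 v0 e zero m≤n = trans u0 (sym v0)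
  𝔎-injective≤ (suc n) {u} {v} u0 v0 e (suc m) (s≤s m≤n) = begin
    u (suc m)   ≈⟨ top u ⟨
    last u      ≈⟨ +-cancelˡ (lower u) (last u) (last v) (trans (e .at (suc m)) (+-congʳ (sym lower≈))) ⟩
    last v      ≈⟨ top v ⟩
    v (suc m)   ∎
    where
    open SetoidReasoning setoid
    open GroupProperties +-group using () renaming (∙-cancelˡ to +-cancelˡ)
    lower last : Seq R → Carrier
    lower w = Σ< m (λ j → ι (m C j) * (D w j * (g ^^ suc m) (m ∸ j)))
    last  w = ι (m C m) * (D w m * (g ^^ suc m) (m ∸ m))
    lower≈ : lower u ≈ lower v
    lower≈ = Σ<-cong m (λ j j<m → *-congˡ (*-congʳ
      (𝔎-injective≤ n u0 v0 e (suc j) (ℕₚ.≤-trans j<m m≤n))))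
    top : ∀ w → last w ≈ w (suc m)
    top w = begin
      ι (m C m) * (D w m * (g ^^ suc m) (m ∸ m))
        ≈⟨ *-cong (ι-C-diag m) (*-congˡ (trans (reflexive (≡.cong (g ^^ suc m) (ℕₚ.n∸n≡0 m))) (^^-0 g refl (suc m)))) ⟩
      1# * (w (suc m) * 1#)
        ≈⟨ trans (*-identityˡ _) (*-identityʳ _) ⟩
      w (suc m) ∎

  -- By `𝔎-S`, both sides have the same image under 𝔎, which is injective on series with constant
  -- term 1.
  S-𝔎 : ∀ u → u 0 ≈ 1# → S (𝔎 R u f) ≐ u
  S-𝔎 u u0 .at n = 𝔎-injective≤ n (S-0 (𝔎 R u f)) u0 (𝔎-S (𝔎 R u f) refl) n ℕₚ.≤-refl

  𝔏-characterisation : ∀ {u v} → u 0 ≈ 1# → v 0 ≈ 1# → u ⊗ S v ≐ 𝟙 → v ≐ 𝔏 R u f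
  𝔏-characterisation {u} {v} u0 v0 uSv = begin
    v                    ≈⟨ reciprocal-unique {𝔎 R u f} Kv (⊗-negInv (𝔎 R u f) refl) ⟩
    -- The multiple by -1 unfolds to a first power of `negInv`, which carries a trailing factor `𝟙`.
    negInv R (𝔎 R u f)   ≈⟨ 𝕊.*-identityʳ (negInv R (𝔎 R u f)) ⟨
    𝔏 R u f              ∎
    where
    open SetoidReasoning 𝕊.setoid
    Kv : 𝔎 R u f ⊗ v ≐ 𝟙
    Kv = begin
      𝔎 R u f ⊗ v              ≈⟨ 𝔎-S (𝔎 R u f ⊗ v) (trans (⊗-0 (𝔎 R u f) v) (trans (*-identityˡ _) v0)) ⟨
      𝔎 R (S (𝔎 R u f ⊗ v)) f  ≈⟨ 𝔎-cong (S-⊗ (𝔎 R u f) v) ⟩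
      𝔎 R (S (𝔎 R u f) ⊗ S v) f ≈⟨ 𝔎-cong (⊗-congʳ (S v) (S-𝔎 u u0)) ⟩
      𝔎 R (u ⊗ S v) f          ≈⟨ 𝔎-cong uSv ⟩
      𝔎 R 𝟙 f                  ≈⟨ 𝔎-𝟙 ⟩
      𝟙                        ∎

-- The series of an inverse exponential Riordan array.

module RiordanInverse {a ℓ : Level} (R : CommutativeRing a ℓ) (ifact : ℕ → CommutativeRing.Carrier R)
    (ifact-inverse : AreReciprocal R (λ n → fromℕ R (n !)) ifact)
    (γ α : Seq R) where
  open CommutativeRing R
  open ScalarSums R
  open ExponentialSeries R
  open DividedPowers R
  open Substitution R α

  expRiordan-column : ∀ γ α n k → expRiordan R γ α n k ≈ (τ k ⊗ (γ ⊗ α ^^ k)) n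
  expRiordan-column γ α n k with k ≤? n
  ... | yes _   = sym (τ-⊗ k (γ ⊗ α ^^ k) n)
  ... | no  k≰n = sym (τ-⊗-vanish (γ ⊗ α ^^ k) (ℕₚ.≰⇒> k≰n))

  idMat-column : ∀ n k → idMat R n k ≈ τ k n
  idMat-column n k with n ≟ k
  ... | yes ≡.refl = sym (τ-diag n)
  ... | no  n≢k    = sym (τ-offdiag n k n≢k)

  -- The fundamental theorem of Riordan arrays: (γ,α) acts on a series b as γ(t) b(t α(t)).
  expRiordan-apply : ∀ b n → Σ< (suc n) (λ j → expRiordan R γ α n j * b j) ≈ (γ ⊗ S b) n
  expRiordan-apply b n = trans
    (Σ<-cong (suc n) (λ j _ → *-congʳ (trans (expRiordan-column γ α n j)
      (solve 3 (λ t c x → t :* (c :* x) := c :* (t :* x)) 𝕊.refl (τ j) γ (α ^^ j) .at n))))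
    (sym (⊗-S γ b n))
    where open NaturalSolver seqSemiring using (solve; _:*_; _:=_)

  -- Since (n+1)! = (n+1) n!, the element n! · `ifact (suc n)` is an inverse of n + 1.
  ι-suc-cancel : ∀ n {x y} → ι (suc n) * x ≈ ι (suc n) * y → x ≈ y
  ι-suc-cancel n {x} {y} e = begin
    x                  ≈⟨ *-identityˡ x ⟨
    1# * x             ≈⟨ *-congʳ unit ⟨
    (r * ι (suc n)) * x ≈⟨ *-assoc _ _ _ ⟩
    r * (ι (suc n) * x) ≈⟨ *-congˡ e ⟩
    r * (ι (suc n) * y) ≈⟨ *-assoc _ _ _ ⟨
    (r * ι (suc n)) * y ≈⟨ *-congʳ unit ⟩
    1# * y             ≈⟨ *-identityˡ y ⟩
    y                  ∎
    where
    open SetoidReasoning setoid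
    open NaturalSolver commutativeSemiring using (solve; _:*_; _:=_)
    r = ι (n !) * ifact (suc n)
    unit : r * ι (suc n) ≈ 1#
    unit = begin
      (ι (n !) * ifact (suc n)) * ι (suc n)  ≈⟨ solve 3 (λ x y z → (x :* y) :* z := (z :* x) :* y) refl _ _ _ ⟩
      (ι (suc n) * ι (n !)) * ifact (suc n)  ≈⟨ *-congʳ (ι-* (suc n) (n !)) ⟨
      ι (suc n !) * ifact (suc n)            ≈⟨ ifact-inverse (suc n) ⟩
      1#                                     ∎

  τ1-⊗-cancel : ∀ {u v} → τ 1 ⊗ u ≐ τ 1 ⊗ v → u ≐ v
  τ1-⊗-cancel {u} {v} e .at n =
    ι-suc-cancel n (trans (sym (τ1-⊗-suc u n)) (trans (e .at (suc n)) (τ1-⊗-suc v n)))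

  module _ (γ0 : γ 0 ≈ 1#) (α0 : α 0 ≈ 1#) {γ″ α″ : Seq R} (γ″0 : γ″ 0 ≈ 1#) (α″0 : α″ 0 ≈ 1#)
           (rightInverse : _≋_ R (_·_ R (expRiordan R γ α) (expRiordan R γ″ α″)) (idMat R)) where
    open Lagrange R α α0

    column : ∀ k → γ ⊗ S (τ k ⊗ (γ″ ⊗ α″ ^^ k)) ≐ τ k
    column k .at n = begin
      (γ ⊗ S (τ k ⊗ (γ″ ⊗ α″ ^^ k))) n
        ≈⟨ expRiordan-apply (τ k ⊗ (γ″ ⊗ α″ ^^ k)) n ⟨
      Σ< (suc n) (λ j → expRiordan R γ α n j * (τ k ⊗ (γ″ ⊗ α″ ^^ k)) j)
        ≈⟨ Σ<-cong (suc n) (λ j _ → *-congˡ (expRiordan-column γ″ α″ j k)) ⟨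
      _·_ R (expRiordan R γ α) (expRiordan R γ″ α″) n k
        ≈⟨ rightInverse n k ⟩
      idMat R n k
        ≈⟨ idMat-column n k ⟩
      τ k n ∎
      where open SetoidReasoning setoid

    γSγ″ : γ ⊗ S γ″ ≐ 𝟙
    γSγ″ = 𝕊.trans (⊗-congˡ γ (S-cong (𝕊.sym (𝕊.trans (𝕊.*-identityˡ (γ″ ⊗ 𝟙)) (𝕊.*-identityʳ γ″))))) (column 0)

    -- Column 1 says γ · S(t γ″ α″) = t. As S is multiplicative, S(t) = t α and γ · S γ″ = 1, this
    -- becomes t · (α · S α″) = t, and the factor t can be cancelled.
    αSα″ : α ⊗ S α″ ≐ 𝟙
    αSα″ = τ1-⊗-cancel (begin
      τ 1 ⊗ (α ⊗ S α″)
        ≈⟨ 𝕊.*-assoc (τ 1) α (S α″) ⟨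
      φ ⊗ S α″
        ≈⟨ 𝕊.*-identityˡ (φ ⊗ S α″) ⟨
      𝟙 ⊗ (φ ⊗ S α″)
        ≈⟨ ⊗-cong γSγ″ (⊗-congʳ (S α″) S-τ1) ⟨
      (γ ⊗ S γ″) ⊗ (S (τ 1) ⊗ S α″)
        ≈⟨ solve 4 (λ c x y z → (c :* x) :* (y :* z) := c :* (y :* (x :* z))) 𝕊.refl γ (S γ″) (S (τ 1)) (S α″) ⟩
      γ ⊗ (S (τ 1) ⊗ (S γ″ ⊗ S α″))
        ≈⟨ ⊗-congˡ γ (⊗-congˡ (S (τ 1)) (S-⊗ γ″ α″)) ⟨
      γ ⊗ (S (τ 1) ⊗ S (γ″ ⊗ α″))
        ≈⟨ ⊗-congˡ γ (S-⊗ (τ 1) (γ″ ⊗ α″)) ⟨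
      γ ⊗ S (τ 1 ⊗ (γ″ ⊗ α″))
        ≈⟨ ⊗-congˡ γ (S-cong (⊗-congˡ (τ 1) (⊗-congˡ γ″ (𝕊.*-identityʳ α″)))) ⟨
      γ ⊗ S (τ 1 ⊗ (γ″ ⊗ α″ ^^ 1))
        ≈⟨ column 1 ⟩
      τ 1
        ≈⟨ 𝕊.*-identityʳ (τ 1) ⟨
      τ 1 ⊗ 𝟙 ∎)
      where
      open SetoidReasoning 𝕊.setoid
      open NaturalSolver seqSemiring using (solve; _:*_; _:=_)

    inverse-γ : γ″ ≐ 𝔏 R γ α
    inverse-γ = 𝔏-characterisation γ0 γ″0 γSγ″

    inverse-α : α″ ≐ 𝔏₁ R α
    inverse-α = 𝔏-characterisation α0 α″0 αSα″

-- The ω-Riordan array is the exponential one conjugated by diag(c n / n!).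
module Conjugation {a ℓ : Level} (R : CommutativeRing a ℓ) (c cinv ifact : ℕ → CommutativeRing.Carrier R)
    (c-inverse : AreReciprocal R c cinv)
    (ifact-inverse : AreReciprocal R (λ n → fromℕ R (n !)) ifact) where
  open CommutativeRing R
  open ScalarSums R
  open ExponentialSeries R using (_≐_; at; ⊗-cong)
  open DividedPowers R using (^^-cong)
  open SetoidReasoning setoid
  open NaturalSolver commutativeSemiring using (solve; _:*_; _:=_)

  d e : ℕ → Carrier
  d n = c n * ifact n
  e n = ι (n !) * cinv n

  ed≈1 : ∀ n → e n * d n ≈ 1#
  ed≈1 n = begin
    (ι (n !) * cinv n) * (c n * ifact n)  ≈⟨ solve 4 (λ x y z w → (x :* y) :* (z :* w) := (z :* y) :* (x :* w)) refl _ _ _ _ ⟩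
    (c n * cinv n) * (ι (n !) * ifact n)  ≈⟨ *-cong (c-inverse n) (ifact-inverse n) ⟩
    1# * 1#                               ≈⟨ *-identityˡ 1# ⟩
    1#                                    ∎

  conj : Mat R → Mat R
  conj A n k = d n * (A n k * e k)

  conj-cong : ∀ {A B} → _≋_ R A B → _≋_ R (conj A) (conj B)
  conj-cong A≋B n k = *-congˡ (*-congʳ (A≋B n k))

  -- The inner factors `e j` and `d j` cancel in every term, as Δ⁻¹ Δ does between the two matrices.
  conj-· : ∀ A B → _≋_ R (_·_ R (conj A) (conj B)) (conj (_·_ R A B))
  conj-· A B n k = begin
    Σ< (suc n) (λ j → (d n * (A n j * e j)) * (d j * (B j k * e k)))
      ≈⟨ Σ<-cong (suc n) (λ j _ → term j) ⟩
    Σ< (suc n) (λ j → d n * ((A n j * B j k) * e k))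
      ≈⟨ Σ<-*ˡ (suc n) (d n) _ ⟩
    d n * Σ< (suc n) (λ j → (A n j * B j k) * e k)
      ≈⟨ *-congˡ (Σ<-*ʳ (suc n) (e k) _) ⟩
    d n * (Σ< (suc n) (λ j → A n j * B j k) * e k) ∎
    where
    term : ∀ j → (d n * (A n j * e j)) * (d j * (B j k * e k)) ≈ d n * ((A n j * B j k) * e k)
    term j = begin
      (d n * (A n j * e j)) * (d j * (B j k * e k))
        ≈⟨ solve 6 (λ x a y z b w → (x :* (a :* y)) :* (z :* (b :* w)) := (y :* z) :* (x :* ((a :* b) :* w))) refl (d n) (A n j) (e j) (d j) (B j k) (e k) ⟩
      (e j * d j) * (d n * ((A n j * B j k) * e k))
        ≈⟨ *-congʳ (ed≈1 j) ⟩
      1# * (d n * ((A n j * B j k) * e k))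
        ≈⟨ *-identityˡ _ ⟩
      d n * ((A n j * B j k) * e k) ∎

  conj-idMat : _≋_ R (conj (idMat R)) (idMat R)
  conj-idMat n k with n ≟ k
  ... | yes ≡.refl = trans (*-congˡ (*-identityˡ _)) (trans (*-comm _ _) (ed≈1 n))
  ... | no  _      = trans (*-congˡ (zeroˡ _)) (zeroʳ _)

  ι-C-factorial : ∀ {n k} → k ≤ n → ι (n C k) * (ι (k !) * ι ((n ∸ k) !)) ≈ ι (n !)
  ι-C-factorial {n} {k} k≤n = begin
    ι (n C k) * (ι (k !) * ι ((n ∸ k) !))   ≈⟨ *-congˡ (ι-* (k !) ((n ∸ k) !)) ⟨
    ι (n C k) * ι (k ! ℕ.* (n ∸ k) !)       ≈⟨ ι-* (n C k) (k ! ℕ.* (n ∸ k) !) ⟨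
    ι ((n C k) ℕ.* (k ! ℕ.* (n ∸ k) !))       ≈⟨ ι-cong (≡.trans (≡.cong (ℕ._* (k ! ℕ.* (n ∸ k) !)) (nCk≡n!/k![n-k]! k≤n))
                                                (m/n*n≡m {{k ℕₚ.!* (n ∸ k) !≢0}} (k![n∸k]!∣n! k≤n))) ⟩
    ι (n !)                                 ∎

  -- In fractions: (c_n/n!) · C(n,k) · (k!/c_k) = (c_n/c_k) / (n-k)!.
  ωRiordan-conj : ∀ γ α → _≋_ R (ωRiordan R c cinv ifact γ α) (conj (expRiordan R γ α))
  ωRiordan-conj γ α n k with k ≤? n
  ... | no  _   = sym (trans (*-congˡ (zeroˡ _)) (zeroʳ _))
  ... | yes k≤n = sym (begin
    (c n * ifact n) * ((nCk * X) * (k! * cinv k))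
      ≈⟨ *-identityˡ _ ⟨
    1# * ((c n * ifact n) * ((nCk * X) * (k! * cinv k)))
      ≈⟨ *-congʳ (ifact-inverse (n ∸ k)) ⟨
    -- The inserted factor (n-k)! completes C(n,k) · k! to n!, which cancels against `ifact n`; its
    -- partner `ifact (n ∸ k)` stays in the result.
    (m! * ifact (n ∸ k)) * ((c n * ifact n) * ((nCk * X) * (k! * cinv k)))
      ≈⟨ solve 8 (λ m im cn i b x k ik → (m :* im) :* ((cn :* i) :* ((b :* x) :* (k :* ik)))
                   := ((b :* (k :* m)) :* i) :* (((cn :* ik) :* im) :* x))
           refl m! (ifact (n ∸ k)) (c n) (ifact n) nCk X k! (cinv k) ⟩
    ((nCk * (k! * m!)) * ifact n) * (((c n * cinv k) * ifact (n ∸ k)) * X)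
      ≈⟨ *-congʳ (trans (*-congʳ (ι-C-factorial k≤n)) (ifact-inverse n)) ⟩
    1# * (((c n * cinv k) * ifact (n ∸ k)) * X)
      ≈⟨ *-identityˡ _ ⟩
    ((c n * cinv k) * ifact (n ∸ k)) * X ∎)
    where
    nCk = ι (n C k)
    X = conv R γ (dotℕ R k α) (n ∸ k)
    k! = ι (k !)
    m! = ι ((n ∸ k) !)

  ωRiordan-cong : ∀ {γ γ′ α α′} → γ ≐ γ′ → α ≐ α′ →
    _≋_ R (ωRiordan R c cinv ifact γ α) (ωRiordan R c cinv ifact γ′ α′)
  ωRiordan-cong γ≐ α≐ n k with k ≤? n
  ... | yes _ = *-congˡ (⊗-cong γ≐ (^^-cong α≐ k) .at (n ∸ k))
  ... | no  _ = refl

  ωRiordan-· : ∀ γ α σ ρ → _≋_ R (_·_ R (ωRiordan R c cinv ifact γ α) (ωRiordan R c cinv ifact σ ρ))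
                                 (conj (_·_ R (expRiordan R γ α) (expRiordan R σ ρ)))
  ωRiordan-· γ α σ ρ n k = trans
    (Σ<-cong (suc n) (λ j _ → *-cong (ωRiordan-conj γ α n j) (ωRiordan-conj σ ρ j k)))
    (conj-· (expRiordan R γ α) (expRiordan R σ ρ) n k)

  ωRiordan-product : ∀ {γ α σ ρ γ′ α′} →
    _≋_ R (_·_ R (expRiordan R γ α) (expRiordan R σ ρ)) (expRiordan R γ′ α′) →
    _≋_ R (_·_ R (ωRiordan R c cinv ifact γ α) (ωRiordan R c cinv ifact σ ρ)) (ωRiordan R c cinv ifact γ′ α′)
  ωRiordan-product {γ} {α} {σ} {ρ} {γ′} {α′} eq n k =
    trans (ωRiordan-· γ α σ ρ n k) (trans (conj-cong eq n k) (sym (ωRiordan-conj γ′ α′ n k)))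

  ωRiordan-identity : ∀ {γ α σ ρ} →
    _≋_ R (_·_ R (expRiordan R γ α) (expRiordan R σ ρ)) (idMat R) →
    _≋_ R (_·_ R (ωRiordan R c cinv ifact γ α) (ωRiordan R c cinv ifact σ ρ)) (idMat R)
  ωRiordan-identity {γ} {α} {σ} {ρ} eq n k =
    trans (ωRiordan-· γ α σ ρ n k) (trans (conj-cong eq n k) (conj-idMat n k))

-- Products and inverses of ω-Riordan arrays.

theorem3p3 : ∀ {a ℓ : Level} (R : CommutativeRing a ℓ) →
  let open CommutativeRing R in
  (c cinv ifact : ℕ → Carrier) →
  (∀ n → c n * cinv n ≈ 1#) → c 0 ≈ 1# →
  (∀ n → fromℕ R (n !) * ifact n ≈ 1#) →
  (γ α σ ρ γ′ α′ γ″ α″ : Seq R) →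
  γ 0 ≈ 1# → α 0 ≈ 1# → σ 0 ≈ 1# → ρ 0 ≈ 1# →
  γ′ 0 ≈ 1# → α′ 0 ≈ 1# → γ″ 0 ≈ 1# → α″ 0 ≈ 1# →
  (_≋_ R (_·_ R (expRiordan R γ α) (expRiordan R σ ρ)) (expRiordan R γ′ α′) →
    _≋_ R (_·_ R (ωRiordan R c cinv ifact γ α) (ωRiordan R c cinv ifact σ ρ))
          (ωRiordan R c cinv ifact γ′ α′))
  ×
  (IsInverseOf R (expRiordan R γ″ α″) (expRiordan R γ α) →
    IsInverseOf R (ωRiordan R c cinv ifact γ″ α″) (ωRiordan R c cinv ifact γ α)
    × _≋_ R (ωRiordan R c cinv ifact γ″ α″)
            (ωRiordan R c cinv ifact (𝔏 R γ α) (𝔏₁ R α)))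
theorem3p3 R c cinv ifact c-inverse c0 ifact-inverse γ α σ ρ γ′ α′ γ″ α″ γ0 α0 σ0 ρ0 γ′0 α′0 γ″0 α″0 =
    ωRiordan-product {γ} {α} {σ} {ρ} {γ′} {α′}
  -- `right` is (γ,α)(γ″,α″) = I and `left` is the opposite order. Conjugation carries both over,
  -- and the columns of `right` identify γ″ and α″.
  , λ (right , left) →
      ( ωRiordan-identity {γ} {α} {γ″} {α″} right
      , ωRiordan-identity {γ″} {α″} {γ} {α} left )
    , ωRiordan-cong (inverse-γ γ0 α0 γ″0 α″0 right) (inverse-α γ0 α0 γ″0 α″0 right)
  where
  open Conjugation R c cinv ifact c-inverse ifact-inverse
  open RiordanInverse R ifact ifact-inverse γ α
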